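{- (Fraïssé's theorem) Fix a UL-chain $\mathbf{A}$ and a predicate language $\mathcal{P}$. Let $\mathscr{K}$ be a countable set of finitely generated $\mathbf{A}$-structures for $\mathcal{P}$. If $\mathscr{K}$ has the hereditary property (HP), the joint embedding property (JEP) and the amalgamation property (AP), then there is a unique (up to isomorphism) countable homogeneous $\mathbf{A}$-structure $\langle\mathbf{A},\mathbf{M}\rangle$ such that $\mathscr{K}=\mathrm{Age}(\mathbf{A},\mathbf{M})$. Moreover, if an $\mathbf{A}$-structure is homogeneous, then its age has AP.
   Context: A UL-algebra is $\mathbf{A}=\langle A,\wedge,\vee,\&,\to,\bar 0,\bar 1,\bot,\top\rangle$ where $\langle A,\wedge,\vee,\bot,\top\rangle$ is a bounded lattice, $\langle A,\&,\bar 1\rangle$ is a commutative monoid, $a\& b\le c$ iff $b\le a\to c$, and $((a\to b)\wedge\bar 1)\vee((b\to a)\wedge \bar 1)=\bar 1$; a UL-chain is one with linear order. An $\mathbf{A}$-structure $\langle\mathbf{A},\mathbf{M}\rangle$ for $\mathcal{P}$ consists of a set $M$ (countable if $M$ is), a function $P_{\mathbf{M}}:M^n\to A$ for each $n$-ary predicate symbol and a function $F_{\mathbf{M}}:M^n\to M$ for each $n$-ary function symbol; quantifier-free formulas (connectives $\wedge,\vee,\&,\to,\bar0,\bar1,\bot,\top$) get values in $A$ by evaluating terms as usual, atoms via $P_{\mathbf{M}}$, connectives via $\mathbf{A}$. Substructure: subset closed under functions, same function values, same values of all quantifier-free formulas on its tuples. Embedding $\langle Id,f\rangle$: injective $f$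 commuting with function symbols and preserving values of all quantifier-free formulas (identity on $\mathbf{A}$); isomorphism: surjective embedding; automorphism: isomorphism of a structure onto itself. Finitely generated: generated by a finite subset under the function symbols. $\mathrm{Age}(\mathbf{A},\mathbf{M})$: the class, up to isomorphism, of finitely generated substructures of $\langle\mathbf{A},\mathbf{M}\rangle$ and their isomorphic copies. HP: closed under substructures. JEP: any two members embed into a common member. AP: whenever $\langle\mathbf{A},\mathbf{M}_0\rangle$ is a substructure of both $\langle\mathbf{A},\mathbf{M}_1\rangle$ and $\langle\mathbf{A},\mathbf{M}_2\rangle$, all in the class, there are a member $\langle\mathbf{A},\mathbf{M}_3\rangle$ and embeddings $\langle Id,f_1\rangle$ of $\mathbf{M}_1$ and $\langle Id,f_2\rangle$ of $\mathbf{M}_2$ into $\mathbf{M}_3$ with $f_1$ and $f_2$ agreeing on $M_0$. A structure is homogeneous if every isomorphism between two finitely generated substructures extends to an automorphism of the structure.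
   Formalization: The formal theorem also assumes that K is non-empty and each of its members is countable. Both are necessary: an age is never empty, and with uncountably many constants a finitely generated structure can be uncountable, so it lies in the age of no countable structure. -}

module Defs where

open import Level using (Level; suc; _⊔_)
open import Data.Nat.Base using (ℕ)
open import Data.Fin.Base using (Fin)
open import Data.Product.Base using (Σ; Σ-syntax; ∃-syntax; _×_; _,_; proj₁; proj₂)
open import Data.Vec.Functional using (Vector; map)
open import Data.Vec.Functional.Relation.Binary.Pointwise using (Pointwise)
open import Function.Base using (_∘_; _on_)
open import Function.Bundles using (Injection; _⇔_; Equivalence)
open import Function.Definitions using (Congruent; Injective; Surjective)
open import Relation.Binary.Bundles using (Setoid)
open import Relation.Binary.Core using (_Preserves₂_⟶_⟶_)
open import Relation.Binary.Definitions using (Total)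
open import Relation.Binary.Lattice.Bundles using (BoundedLattice)
import Relation.Binary.Lattice.Properties.JoinSemilattice as JoinProperties
import Relation.Binary.Lattice.Properties.MeetSemilattice as MeetProperties
import Relation.Binary.PropositionalEquality.Properties as ≡
open import Relation.Unary using (Pred)
open import Algebra.Core using (Op₂)
open import Algebra.Structures using (IsCommutativeMonoid)

record ULAlgebra (ℓ : Level) : Set (suc ℓ) where
  infixr 7 _&_
  infixr 5 _⇒_
  field
    boundedLattice : BoundedLattice ℓ ℓ ℓ

  open BoundedLattice boundedLattice public

  field
    _&_                 : Op₂ Carrier
    _⇒_                 : Op₂ Carrier
    0̄                   : Carrier
    1̄                   : Carrier
    isCommutativeMonoid : IsCommutativeMonoid _≈_ _&_ 1̄
    residuated          : ∀ a b c → (a & b ≤ c) ⇔ (b ≤ a ⇒ c)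
    prelinear           : ∀ a b → ((a ⇒ b) ∧ 1̄) ∨ ((b ⇒ a) ∧ 1̄) ≈ 1̄

  open IsCommutativeMonoid isCommutativeMonoid public using ()
    renaming (∙-cong to &-cong)

  -- A congruence law for _⇒_ need not be assumed: it follows from residuation.
  ⇒-mono : ∀ {a a′ b b′} → a′ ≈ a → b ≤ b′ → a ⇒ b ≤ a′ ⇒ b′
  ⇒-mono {a} {a′} {b} {b′} a′≈a b≤b′ =
    Equivalence.to (residuated a′ (a ⇒ b) b′)
      (trans (reflexive (&-cong a′≈a Eq.refl))
        (trans (Equivalence.from (residuated a (a ⇒ b) b) refl) b≤b′))

  ⇒-cong : _⇒_ Preserves₂ _≈_ ⟶ _≈_ ⟶ _≈_
  ⇒-cong a≈a′ b≈b′ =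
    antisym (⇒-mono (Eq.sym a≈a′) (reflexive b≈b′))
            (⇒-mono a≈a′ (reflexive (Eq.sym b≈b′)))

IsULChain : ∀ {ℓ} → ULAlgebra ℓ → Set ℓ
IsULChain 𝔸 = Total (ULAlgebra._≤_ 𝔸)

record Language (ℓ : Level) : Set (suc ℓ) where
  field
    PredSym   : Set ℓ
    predArity : PredSym → ℕ
    FunSym    : Set ℓ
    funArity  : FunSym → ℕ

module _ {ℓ : Level} (𝒫 : Language ℓ) where
  open Language 𝒫

  data Term (n : ℕ) : Set ℓ where
    var : Fin n → Term n
    fun : (F : FunSym) → Vector (Term n) (funArity F) → Term n

  -- Quantifier-free formulas in n variables.  There is no equality atom.
  data Formula (n : ℕ) : Set ℓ where
    atom                : (P : PredSym) → Vector (Term n) (predArity P) → Formula n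
    _∧ᶠ_ _∨ᶠ_ _&ᶠ_ _⇒ᶠ_ : Formula n → Formula n → Formula n
    0̄ᶠ 1̄ᶠ ⊥ᶠ ⊤ᶠ         : Formula n

-- The domain is a setoid, whose equality plays the role of identity of
-- elements.  It may be empty.
record Structure {ℓ : Level} (𝔸 : ULAlgebra ℓ) (𝒫 : Language ℓ) : Set (suc ℓ) where
  open Language 𝒫
  private module A = ULAlgebra 𝔸
  field
    domain : Setoid ℓ ℓ

  open Setoid domain public

  field
    funᴹ      : (F : FunSym) → Vector Carrier (funArity F) → Carrier
    funᴹ-cong : ∀ F {xs ys} → Pointwise _≈_ xs ys → funᴹ F xs ≈ funᴹ F ys
    predᴹ      : (P : PredSym) → Vector Carrier (predArity P) → A.Carrier
    predᴹ-cong : ∀ P {xs ys} → Pointwise _≈_ xs ys → predᴹ P xs A.≈ predᴹ P ys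

  ⟦_⟧ᵗ : ∀ {n} → Term 𝒫 n → Vector Carrier n → Carrier
  ⟦ var i    ⟧ᵗ v = v i
  ⟦ fun F ts ⟧ᵗ v = funᴹ F (λ i → ⟦ ts i ⟧ᵗ v)

  ⟦_⟧ : ∀ {n} → Formula 𝒫 n → Vector Carrier n → A.Carrier
  ⟦ atom P ts ⟧ v = predᴹ P (λ i → ⟦ ts i ⟧ᵗ v)
  ⟦ φ ∧ᶠ ψ    ⟧ v = ⟦ φ ⟧ v A.∧ ⟦ ψ ⟧ v
  ⟦ φ ∨ᶠ ψ    ⟧ v = ⟦ φ ⟧ v A.∨ ⟦ ψ ⟧ v
  ⟦ φ &ᶠ ψ    ⟧ v = ⟦ φ ⟧ v A.& ⟦ ψ ⟧ v
  ⟦ φ ⇒ᶠ ψ    ⟧ v = ⟦ φ ⟧ v A.⇒ ⟦ ψ ⟧ v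
  ⟦ 0̄ᶠ        ⟧ v = A.0̄
  ⟦ 1̄ᶠ        ⟧ v = A.1̄
  ⟦ ⊥ᶠ        ⟧ v = A.⊥
  ⟦ ⊤ᶠ        ⟧ v = A.⊤

module _ {ℓ : Level} {𝔸 : ULAlgebra ℓ} {𝒫 : Language ℓ} where
  open Language 𝒫
  private
    module A = ULAlgebra 𝔸
    Str : Set (suc ℓ)
    Str = Structure 𝔸 𝒫
  open Structure using (Carrier)

  infix 4 _↪_ _≅_

  record _↪_ (M N : Str) : Set ℓ where
    private
      module M = Structure M
      module N = Structure N
    field
      to        : M.Carrier → N.Carrier
      cong      : Congruent M._≈_ N._≈_ to
      injective : Injective M._≈_ N._≈_ to
      commutes  : ∀ F xs → to (M.funᴹ F xs) N.≈ N.funᴹ F (map to xs)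
      preserves : ∀ {n} (φ : Formula 𝒫 n) (v : Vector M.Carrier n) →
                  M.⟦ φ ⟧ v A.≈ N.⟦ φ ⟧ (map to v)

  record _≅_ (M N : Str) : Set ℓ where
    field
      embedding : M ↪ N

    open _↪_ embedding public

    field
      surjective : Surjective (Structure._≈_ M) (Structure._≈_ N) to

  Automorphism : Str → Set ℓ
  Automorphism M = M ≅ M

  -- Subsets closed under the function symbols.  The accompanying structure
  -- is _↾_, with functions and predicates restricted; that all
  -- quantifier-free formulas then keep their values is ↾-inclusion.
  record Substructure (M : Str) : Set (suc ℓ) where
    open Structure M using (_≈_; funᴹ)
    field
      member : Pred (Carrier M) ℓ
      resp   : ∀ {x y} → x ≈ y → member x → member y
      closed : ∀ F {xs} → (∀ i → member (xs i)) → member (funᴹ F xs)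

  infixl 8 _↾_

  _↾_ : (M : Str) → Substructure M → Str
  M ↾ S = record
    { domain     = record
      { Carrier       = Σ M.Carrier S.member
      ; _≈_           = M._≈_ on proj₁
      ; isEquivalence = record { refl = M.refl ; sym = M.sym ; trans = M.trans }
      }
    ; funᴹ       = λ F xs → M.funᴹ F (map proj₁ xs) , S.closed F (proj₂ ∘ xs)
    ; funᴹ-cong  = λ F → M.funᴹ-cong F
    ; predᴹ      = λ P xs → M.predᴹ P (map proj₁ xs)
    ; predᴹ-cong = λ P → M.predᴹ-cong P
    }
    where
    module M = Structure M
    module S = Substructure S

  ↾-inclusion : (M : Str) (S : Substructure M) → M ↾ S ↪ M
  ↾-inclusion M S = record
    { to        = proj₁
    ; cong      = λ x≈y → x≈y
    ; injective = λ x≈y → x≈y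
    ; commutes  = λ F xs → M.refl
    ; preserves = values
    }
    where
    module M = Structure M
    module N = Structure (M ↾ S)
    open JoinProperties A.joinSemilattice using (∨-cong)
    open MeetProperties A.meetSemilattice using (∧-cong)

    term : ∀ {n} (t : Term 𝒫 n) v → proj₁ (N.⟦ t ⟧ᵗ v) M.≈ M.⟦ t ⟧ᵗ (map proj₁ v)
    term (var i)    v = M.refl
    term (fun F ts) v = M.funᴹ-cong F (λ i → term (ts i) v)

    values : ∀ {n} (φ : Formula 𝒫 n) v → N.⟦ φ ⟧ v A.≈ M.⟦ φ ⟧ (map proj₁ v)
    values (atom P ts) v = M.predᴹ-cong P (λ i → term (ts i) v)
    values (φ ∧ᶠ ψ)    v = ∧-cong (values φ v) (values ψ v)
    values (φ ∨ᶠ ψ)    v = ∨-cong (values φ v) (values ψ v)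
    values (φ &ᶠ ψ)    v = A.&-cong (values φ v) (values ψ v)
    values (φ ⇒ᶠ ψ)    v = A.⇒-cong (values φ v) (values ψ v)
    values 0̄ᶠ          v = A.Eq.refl
    values 1̄ᶠ          v = A.Eq.refl
    values ⊥ᶠ          v = A.Eq.refl
    values ⊤ᶠ          v = A.Eq.refl

  data Generated (M : Str) {n : ℕ} (xs : Vector (Carrier M) n) : Pred (Carrier M) ℓ where
    gen  : ∀ i → Generated M xs (xs i)
    fun  : ∀ F {ys} → (∀ i → Generated M xs (ys i)) →
           Generated M xs (Structure.funᴹ M F ys)
    resp : ∀ {x y} → Structure._≈_ M x y → Generated M xs x → Generated M xs y

  FinitelyGenerated : Str → Set ℓ
  FinitelyGenerated M =
    Σ[ n ∈ ℕ ] Σ[ xs ∈ Vector (Carrier M) n ] (∀ x → Generated M xs x)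

  -- Finite and empty structures count as countable.
  Countable : Str → Set ℓ
  Countable M = Injection (Structure.domain M) (≡.setoid ℕ)

  Age : Str → Pred Str (suc ℓ)
  Age M N = Σ[ S ∈ Substructure M ] (FinitelyGenerated (M ↾ S) × (N ≅ M ↾ S))

  -- A set of structures, given as a family, read up to isomorphism.
  IsoClosure : {I : Set ℓ} → (I → Str) → Pred Str ℓ
  IsoClosure K N = ∃[ i ] (N ≅ K i)

  -- Classes here consist of finitely generated structures, so only finitely
  -- generated substructures are candidates for membership.
  HP : ∀ {k} → Pred Str k → Set (suc ℓ ⊔ k)
  HP 𝒦 = ∀ {M} → 𝒦 M → (S : Substructure M) → FinitelyGenerated (M ↾ S) → 𝒦 (M ↾ S)

  JEP : ∀ {k} → Pred Str k → Set (suc ℓ ⊔ k)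
  JEP 𝒦 = ∀ {M₁ M₂} → 𝒦 M₁ → 𝒦 M₂ → ∃[ M₃ ] (𝒦 M₃ × (M₁ ↪ M₃) × (M₂ ↪ M₃))

  -- M₀ being a substructure of both M₁ and M₂ is given by the two inclusion
  -- maps ι₁ and ι₂: distinct types share no elements.
  AP : ∀ {k} → Pred Str k → Set (suc ℓ ⊔ k)
  AP 𝒦 = ∀ {M₀ M₁ M₂} → 𝒦 M₀ → 𝒦 M₁ → 𝒦 M₂ → (ι₁ : M₀ ↪ M₁) (ι₂ : M₀ ↪ M₂) →
    Σ[ M₃ ∈ Str ] (𝒦 M₃ × Σ[ f₁ ∈ M₁ ↪ M₃ ] Σ[ f₂ ∈ M₂ ↪ M₃ ]
      (∀ x → Structure._≈_ M₃ (_↪_.to f₁ (_↪_.to ι₁ x)) (_↪_.to f₂ (_↪_.to ι₂ x))))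

  Homogeneous : Str → Set (suc ℓ)
  Homogeneous M = (S T : Substructure M) →
    FinitelyGenerated (M ↾ S) → FinitelyGenerated (M ↾ T) →
    (f : M ↾ S ≅ M ↾ T) →
    Σ[ g ∈ Automorphism M ]
      (∀ x → Structure._≈_ M (_≅_.to g (proj₁ x)) (proj₁ (_≅_.to f x)))

{-# OPTIONS --safe #-}

-- Finitely generated substructures are handled through tuples of generators:
-- two tuples have the same type if they satisfy the same equations between
-- terms and give the same values to atoms, which is exactly when sending one
-- to the other extends to an isomorphism of the generated substructures.
-- M has the extension property if every tuple of M with the type of a tuple
-- bs in some K i is the image of bs under an embedding of K i.  For countable
-- structures with age K this property yields isomorphisms by back-and-forth,
-- hence both homogeneity and uniqueness; conversely homogeneity implies it.
-- A structure with the property is the union of a chain of members of K in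
-- which AP is used to solve every extension problem at some stage.  JEP makes
-- all empty tuples have the same type, so every K i embeds in the union.
-- If M itself is homogeneous, two embeddings of M₀ into M differ by an
-- automorphism, and the amalgam is found inside M.

module Submission where

open import Defs
open import Axiom.ExcludedMiddle using (ExcludedMiddle)
open import Data.Empty using (⊥)
open import Data.Fin.Base using (Fin; zero; suc; toℕ; _↑ˡ_; _↑ʳ_)
open import Data.Nat.Base using (ℕ; zero; suc; _+_; _⊔_; _≤_; z≤n; s≤s;
  _≤′_; ≤′-refl; ≤′-step)
import Data.Nat.Properties as ℕ
open import Data.Product.Base using (Σ-syntax; ∃-syntax; _×_; _,_; proj₁; proj₂)
open import Data.Sum.Base using (inj₁; inj₂)
open import Data.Vec.Functional using (Vector; map; _∷_; []; _++_)
open import Data.Vec.Functional.Properties using (lookup-++ˡ; lookup-++ʳ)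
open import Function.Base using (_∘_; id)
open import Function.Bundles using (_↣_; Injection)
open import Function.Definitions using (Congruent; Injective)
open import Level using (Level; Lift; lift; lower)
open import Relation.Binary.PropositionalEquality as ≡ using (_≡_; refl; subst)
open import Relation.Nullary.Decidable.Core using (Dec; yes; no)
open import Relation.Nullary.Negation.Core using (contradiction)
open import Relation.Unary using (_≐_; _⊆_)
import Relation.Binary.Lattice.Properties.JoinSemilattice as JoinProperties
import Relation.Binary.Lattice.Properties.MeetSemilattice as MeetProperties

-- Coding pairs and finite sequences by numbers.

next : ℕ × ℕ → ℕ × ℕ
next (a , zero)  = zero , suc a
next (a , suc b) = suc a , b

-- Walks through ℕ × ℕ along the antidiagonals.
unpair : ℕ → ℕ × ℕ
unpair zero    = zero , zero
unpair (suc n) = next (unpair n)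

-- Runs the walk backwards: `(suc a , b)` comes after `(a , suc b)`, and `(zero , suc b)` comes
-- after `(b , zero)` on the previous antidiagonal. The sum `s` makes the recursion terminate, since
-- it drops whenever `a` does not.
unpair-surjective : ∀ s a b → a + b ≡ s → ∃[ n ] unpair n ≡ (a , b)
unpair-surjective s       zero    zero    _  = zero , refl
unpair-surjective s       (suc a) b       eq =
  let n , e = unpair-surjective s a (suc b) (≡.trans (ℕ.+-suc a b) eq)
  in suc n , ≡.cong next e
unpair-surjective (suc s) zero    (suc b) eq =
  let n , e = unpair-surjective s b zero (≡.trans (ℕ.+-identityʳ b) (ℕ.suc-injective eq))
  in suc n , ≡.cong next e

pair : ℕ → ℕ → ℕ
pair a b = proj₁ (unpair-surjective (a + b) a b refl)

unpair-pair : ∀ a b → unpair (pair a b) ≡ (a , b)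
unpair-pair a b = proj₂ (unpair-surjective (a + b) a b refl)

unpair-pair₁ : ∀ a b → proj₁ (unpair (pair a b)) ≡ a
unpair-pair₁ a b = ≡.cong proj₁ (unpair-pair a b)

pair-injectiveʳ : ∀ a b c → pair a b ≡ pair a c → b ≡ c
pair-injectiveʳ a b c eq = ≡.trans (≡.sym (≡.cong proj₂ (unpair-pair a b)))
  (≡.trans (≡.cong (proj₂ ∘ unpair) eq) (≡.cong proj₂ (unpair-pair a c)))

unpair-proj₁≤ : ∀ n → proj₁ (unpair n) ≤ n
unpair-proj₁≤ zero    = z≤n
unpair-proj₁≤ (suc n) with unpair n | unpair-proj₁≤ n
... | a , zero  | _   = z≤n
... | a , suc b | a≤n = s≤s a≤n

-- Every finite sequence is an initial segment of the sequence of entries of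
-- some number (encode), so numbers also code tuples and tasks.
entry : ℕ → ℕ → ℕ
entry n zero    = proj₁ (unpair n)
entry n (suc l) = entry (proj₂ (unpair n)) l

encode : ∀ {k} (v : Vector ℕ k) → ∃[ n ] (∀ i → entry n (toℕ i) ≡ v i)
encode {zero}  v = zero , λ ()
encode {suc k} v = let m , h = encode (v ∘ suc) in pair (v zero) m , λ where
  zero    → ≡.cong proj₁ (unpair-pair (v zero) m)
  (suc i) → ≡.trans (≡.cong (λ p → entry (proj₂ p) (toℕ i)) (unpair-pair (v zero) m)) (h i)

upperBound : ∀ {k} (v : Vector ℕ k) → ∃[ m ] (∀ i → v i ≤′ m)
upperBound {zero}  v = zero , λ ()
upperBound {suc k} v = let m , h = upperBound (v ∘ suc) in v zero ⊔ m , λ where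
  zero    → ℕ.≤⇒≤′ (ℕ.m≤m⊔n (v zero) m)
  (suc i) → ℕ.≤⇒≤′ (ℕ.≤-trans (ℕ.≤′⇒≤ (h i)) (ℕ.m≤n⊔m (v zero) m))

module _ {ℓ : Level} {𝔸 : ULAlgebra ℓ} {𝒫 : Language ℓ} where
  open Language 𝒫
  private
    module A = ULAlgebra 𝔸
    Str : Set (Level.suc ℓ)
    Str = Structure 𝔸 𝒫
  open Structure using (Carrier; ⟦_⟧ᵗ; funᴹ; predᴹ)
  open _↪_ using (to)

  -- Embeddings and isomorphisms of structures.

  term-cong : ∀ (M : Str) {n} (t : Term 𝒫 n) {v w : Vector (Carrier M) n} →
              (∀ i → Structure._≈_ M (v i) (w i)) →
              Structure._≈_ M (⟦_⟧ᵗ M t v) (⟦_⟧ᵗ M t w)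
  term-cong M (var i)    v≈w = v≈w i
  term-cong M (fun F ts) v≈w = Structure.funᴹ-cong M F (λ i → term-cong M (ts i) v≈w)

  module _ (M N : Str) where
    private
      module M = Structure M
      module N = Structure N

    module _ (f : M.Carrier → N.Carrier) (f-cong : Congruent M._≈_ N._≈_ f)
             (f-fun : ∀ F xs → f (M.funᴹ F xs) N.≈ N.funᴹ F (map f xs)) where

      term-homo : ∀ {n} (t : Term 𝒫 n) v → f (M.⟦ t ⟧ᵗ v) N.≈ N.⟦ t ⟧ᵗ (map f v)
      term-homo (var i)    v = N.refl
      term-homo (fun F ts) v =
        N.trans (f-fun F _) (N.funᴹ-cong F (λ i → term-homo (ts i) v))

      module _ (f-pred : ∀ P xs → M.predᴹ P xs A.≈ N.predᴹ P (map f xs)) where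
        open JoinProperties A.joinSemilattice using (∨-cong)
        open MeetProperties A.meetSemilattice using (∧-cong)

        formula-homo : ∀ {n} (φ : Formula 𝒫 n) v → M.⟦ φ ⟧ v A.≈ N.⟦ φ ⟧ (map f v)
        formula-homo (atom P ts) v =
          A.Eq.trans (f-pred P _) (N.predᴹ-cong P (λ i → term-homo (ts i) v))
        formula-homo (φ ∧ᶠ ψ)    v = ∧-cong (formula-homo φ v) (formula-homo ψ v)
        formula-homo (φ ∨ᶠ ψ)    v = ∨-cong (formula-homo φ v) (formula-homo ψ v)
        formula-homo (φ &ᶠ ψ)    v = A.&-cong (formula-homo φ v) (formula-homo ψ v)
        formula-homo (φ ⇒ᶠ ψ)    v = A.⇒-cong (formula-homo φ v) (formula-homo ψ v)
        formula-homo 0̄ᶠ          v = A.Eq.refl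
        formula-homo 1̄ᶠ          v = A.Eq.refl
        formula-homo ⊥ᶠ          v = A.Eq.refl
        formula-homo ⊤ᶠ          v = A.Eq.refl

        -- Function symbols and atoms suffice, by induction on formulas. Injectivity is a separate
        -- demand because formulas have no equality atom.
        embedding : Injective M._≈_ N._≈_ f → M ↪ N
        embedding f-inj = record
          { to = f ; cong = f-cong ; injective = f-inj
          ; commutes = f-fun ; preserves = formula-homo }

  module _ {M N : Str} (f : M ↪ N) where
    private
      module M = Structure M
      module N = Structure N
      module f = _↪_ f

    ↪-term : ∀ {n} (t : Term 𝒫 n) v → f.to (M.⟦ t ⟧ᵗ v) N.≈ N.⟦ t ⟧ᵗ (map f.to v)
    ↪-term = term-homo M N f.to f.cong f.commutes

    ↪-pred : ∀ P xs → M.predᴹ P xs A.≈ N.predᴹ P (map f.to xs)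
    ↪-pred P xs = f.preserves (atom P var) xs

    toIso : (∀ y → ∃[ x ] f.to x N.≈ y) → M ≅ N
    toIso surj = record
      { embedding  = f
      ; surjective = λ y → let x , fx≈y = surj y in x , λ z≈x → N.trans (f.cong z≈x) fx≈y
      }

  ↪-refl : ∀ {M : Str} → M ↪ M
  ↪-refl {M} = record
    { to = id ; cong = id ; injective = id
    ; commutes = λ F xs → Structure.refl M ; preserves = λ φ v → A.Eq.refl }

  ↪-trans : ∀ {L M N : Str} → L ↪ M → M ↪ N → L ↪ N
  ↪-trans {N = N} f g = record
    { to        = g.to ∘ f.to
    ; cong      = g.cong ∘ f.cong
    ; injective = f.injective ∘ g.injective
    ; commutes  = λ F xs → Structure.trans N (g.cong (f.commutes F xs)) (g.commutes F _)
    ; preserves = λ φ v → A.Eq.trans (f.preserves φ v) (g.preserves φ _)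
    }
    where
    module f = _↪_ f
    module g = _↪_ g

  ≅⇒↪ : ∀ {M N : Str} → M ≅ N → M ↪ N
  ≅⇒↪ = _≅_.embedding

  ≅-surj : ∀ {M N : Str} (f : M ≅ N) y → ∃[ x ] Structure._≈_ N (_≅_.to f x) y
  ≅-surj {M} f y = let x , h = _≅_.surjective f y in x , h (Structure.refl M)

  ≅-refl : ∀ {M : Str} → M ≅ M
  ≅-refl {M} = toIso ↪-refl (λ y → y , Structure.refl M)

  ≅-trans : ∀ {L M N : Str} → L ≅ M → M ≅ N → L ≅ N
  ≅-trans {N = N} f g = toIso (↪-trans (≅⇒↪ f) (≅⇒↪ g)) λ z →
    let y , gy≈z = ≅-surj g z
        x , fx≈y = ≅-surj f y
    in x , Structure.trans N (_≅_.cong g fx≈y) gy≈z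

  -- Types of tuples.

  record SameType (M : Str) {n} (xs : Vector (Carrier M) n)
                  (N : Str) (ys : Vector (Carrier N) n) : Set ℓ where
    private
      module M = Structure M
      module N = Structure N
    field
      ≈⇒   : ∀ t s → M.⟦ t ⟧ᵗ xs M.≈ M.⟦ s ⟧ᵗ xs → N.⟦ t ⟧ᵗ ys N.≈ N.⟦ s ⟧ᵗ ys
      ≈⇐   : ∀ t s → N.⟦ t ⟧ᵗ ys N.≈ N.⟦ s ⟧ᵗ ys → M.⟦ t ⟧ᵗ xs M.≈ M.⟦ s ⟧ᵗ xs
      pred : ∀ P (ts : Vector (Term 𝒫 n) (predArity P)) →
             M.predᴹ P (λ i → M.⟦ ts i ⟧ᵗ xs) A.≈ N.predᴹ P (λ i → N.⟦ ts i ⟧ᵗ ys)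

  open SameType

  SameType-sym : ∀ {M N : Str} {n} {xs : Vector (Carrier M) n} {ys} →
                 SameType M xs N ys → SameType N ys M xs
  SameType-sym p = record
    { ≈⇒ = ≈⇐ p ; ≈⇐ = ≈⇒ p ; pred = λ P ts → A.Eq.sym (pred p P ts) }

  SameType-trans : ∀ {L M N : Str} {n} {xs : Vector (Carrier L) n} {ys zs} →
                   SameType L xs M ys → SameType M ys N zs → SameType L xs N zs
  SameType-trans p q = record
    { ≈⇒   = λ t s → ≈⇒ q t s ∘ ≈⇒ p t s
    ; ≈⇐   = λ t s → ≈⇐ p t s ∘ ≈⇐ q t s
    ; pred = λ P ts → A.Eq.trans (pred p P ts) (pred q P ts)
    }

  SameType-pointwise : ∀ (M : Str) {n} {xs ys : Vector (Carrier M) n} →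
                       (∀ i → Structure._≈_ M (xs i) (ys i)) → SameType M xs M ys
  SameType-pointwise M {xs = xs} {ys} xs≈ys = record
    { ≈⇒   = λ t s e → trans (sym (term-cong M t xs≈ys)) (trans e (term-cong M s xs≈ys))
    ; ≈⇐   = λ t s e → trans (term-cong M t xs≈ys) (trans e (sym (term-cong M s xs≈ys)))
    ; pred = λ P ts → predᴹ-cong P (λ i → term-cong M (ts i) xs≈ys)
    }
    where open Structure M using (trans; sym; predᴹ-cong)

  ↪-SameType : ∀ {M N : Str} (f : M ↪ N) {n} (xs : Vector (Carrier M) n) →
               SameType M xs N (map (to f) xs)
  ↪-SameType {M} {N} f xs = record
    { ≈⇒   = λ t s e → N.trans (N.sym (↪-term f t xs)) (N.trans (f.cong e) (↪-term f s xs))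
    ; ≈⇐   = λ t s e →
        f.injective (N.trans (↪-term f t xs) (N.trans e (N.sym (↪-term f s xs))))
    ; pred = λ P ts →
        A.Eq.trans (↪-pred f P _) (N.predᴹ-cong P (λ i → ↪-term f (ts i) xs))
    }
    where
    module N = Structure N
    module f = _↪_ f

  -- The type of the empty tuple records the equations and atom values of closed terms, so it is not
  -- trivial in general. Vectors being functions, the image of `[]` is `[]` only pointwise.
  SameType-[] : ∀ {M N : Str} → M ↪ N → SameType M [] N []
  SameType-[] {N = N} f = SameType-trans (↪-SameType f []) (SameType-pointwise N λ ())

  substᵗ : ∀ {m n} → Term 𝒫 m → Vector (Term 𝒫 n) m → Term 𝒫 n
  substᵗ (var i)    ss = ss i
  substᵗ (fun F ts) ss = fun F (λ i → substᵗ (ts i) ss)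

  substᵗ-value : ∀ (M : Str) {m n} (t : Term 𝒫 m) (ss : Vector (Term 𝒫 n) m) xs →
                 Structure._≈_ M (⟦_⟧ᵗ M (substᵗ t ss) xs) (⟦_⟧ᵗ M t (λ i → ⟦_⟧ᵗ M (ss i) xs))
  substᵗ-value M (var i)    ss xs = Structure.refl M
  substᵗ-value M (fun F ts) ss xs =
    Structure.funᴹ-cong M F (λ i → substᵗ-value M (ts i) ss xs)

  -- By substitution, an equation or atom about the values of `ss` becomes one about the original
  -- tuple.
  SameType-terms : ∀ {M N : Str} {m n} {xs : Vector (Carrier M) n} {ys} →
                   SameType M xs N ys → (ss : Vector (Term 𝒫 n) m) →
                   SameType M (λ i → ⟦_⟧ᵗ M (ss i) xs) N (λ i → ⟦_⟧ᵗ N (ss i) ys)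
  SameType-terms {M} {N} {xs = xs} {ys} p ss = record
    { ≈⇒   = λ t s e → N.trans (N.sym (valueᴺ t)) (N.trans
        (≈⇒ p (substᵗ t ss) (substᵗ s ss)
          (M.trans (valueᴹ t) (M.trans e (M.sym (valueᴹ s))))) (valueᴺ s))
    ; ≈⇐   = λ t s e → M.trans (M.sym (valueᴹ t)) (M.trans
        (≈⇐ p (substᵗ t ss) (substᵗ s ss)
          (N.trans (valueᴺ t) (N.trans e (N.sym (valueᴺ s))))) (valueᴹ s))
    ; pred = λ P ts → A.Eq.trans (M.predᴹ-cong P (λ i → M.sym (valueᴹ (ts i))))
        (A.Eq.trans (pred p P (λ i → substᵗ (ts i) ss)) (N.predᴹ-cong P (λ i → valueᴺ (ts i))))
    }
    where
    module M = Structure M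
    module N = Structure N
    valueᴹ = λ t → substᵗ-value M t ss xs
    valueᴺ = λ t → substᵗ-value N t ss ys

  -- Embeddings from coherent relations.

  module _ {M N : Str} (R : Carrier M → Carrier N → Set ℓ)
           (coherent : ∀ {n} (xs : Vector (Carrier M) n) ys →
                       (∀ i → R (xs i) (ys i)) → SameType M xs N ys)
           (total : ∀ x → ∃[ y ] R x y) where
    private
      module M = Structure M
      module N = Structure N

      R-pair : ∀ {x x′ y y′} → R x y → R x′ y′ →
               SameType M (x ∷ x′ ∷ []) N (y ∷ y′ ∷ [])
      R-pair r r′ = coherent _ _ λ { zero → r ; (suc zero) → r′ }

    -- Coherence is applied to small tuples: two matched pairs give well-definedness and
    -- injectivity, a value put in front of its arguments gives commutation with `F`, and the
    -- arguments alone give the atoms.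
    relation⇒↪ : M ↪ N
    relation⇒↪ = embedding M N (proj₁ ∘ total)
      (≈⇒ (R-pair (proj₂ (total _)) (proj₂ (total _))) (var zero) (var (suc zero)))
      (λ F xs → ≈⇒
        (coherent (M.funᴹ F xs ∷ xs) (proj₁ (total (M.funᴹ F xs)) ∷ (proj₁ ∘ total ∘ xs))
          λ { zero → proj₂ (total _) ; (suc i) → proj₂ (total (xs i)) })
        (var zero) (fun F (var ∘ suc)) M.refl)
      (λ P xs → pred (coherent xs _ (λ i → proj₂ (total (xs i)))) P var)
      (≈⇐ (R-pair (proj₂ (total _)) (proj₂ (total _))) (var zero) (var (suc zero)))

    relation⇒↪-unique : ∀ {x y} → R x y → to relation⇒↪ x N.≈ y
    relation⇒↪-unique r =
      ≈⇒ (R-pair (proj₂ (total _)) r) (var zero) (var (suc zero)) M.refl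

    relation⇒≅ : (∀ y → ∃[ x ] R x y) → M ≅ N
    relation⇒≅ surj = toIso relation⇒↪ λ y →
      let x , r = surj y in x , relation⇒↪-unique r

  -- Generated substructures and the age.

  Generates : (M : Str) {n : ℕ} → Vector (Carrier M) n → Set ℓ
  Generates M xs = ∀ x → Generated M xs x

  generated-term : ∀ {M : Str} {n} {xs : Vector (Carrier M) n} {x} → Generated M xs x →
                   Σ[ t ∈ Term 𝒫 n ] Structure._≈_ M (⟦_⟧ᵗ M t xs) x
  generated-term {M} (gen i)    = var i , Structure.refl M
  generated-term {M} (fun F gs) =
    fun F (λ i → proj₁ (generated-term (gs i))) ,
    Structure.funᴹ-cong M F (λ i → proj₂ (generated-term (gs i)))
  generated-term {M} (resp e g) =
    let t , e′ = generated-term g in t , Structure.trans M e′ e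

  generated-map : ∀ {M N : Str} (f : M ↪ N) {n} {xs : Vector (Carrier M) n} {x} →
                  Generated M xs x → Generated N (map (to f) xs) (to f x)
  generated-map f (gen i)    = gen i
  generated-map {N = N} f (fun F gs) =
    resp (Structure.sym N (_↪_.commutes f F _)) (fun F (λ i → generated-map f (gs i)))
  generated-map f (resp e g) = resp (_↪_.cong f e) (generated-map f g)

  generated-mono : ∀ {M : Str} {m n} {xs : Vector (Carrier M) m} {ys : Vector (Carrier M) n} →
                   (∀ i → Generated M ys (xs i)) → ∀ {x} → Generated M xs x → Generated M ys x
  generated-mono h (gen i)    = h i
  generated-mono h (fun F gs) = fun F (λ i → generated-mono h (gs i))
  generated-mono h (resp e g) = resp e (generated-mono h g)

  ↪-agree : ∀ {M N : Str} (f g : M ↪ N) {n} {xs : Vector (Carrier M) n} →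
            (∀ i → Structure._≈_ N (to f (xs i)) (to g (xs i))) →
            ∀ {x} → Generated M xs x → Structure._≈_ N (to f x) (to g x)
  ↪-agree f g h (gen i) = h i
  ↪-agree {N = N} f g h (fun F gs) =
    N.trans (_↪_.commutes f F _)
      (N.trans (N.funᴹ-cong F (λ i → ↪-agree f g h (gs i))) (N.sym (_↪_.commutes g F _)))
    where module N = Structure N
  ↪-agree {N = N} f g h (resp e p) =
    N.trans (N.sym (_↪_.cong f e)) (N.trans (↪-agree f g h p) (_↪_.cong g e))
    where module N = Structure N

  ≅-generates : ∀ {M N : Str} (f : M ≅ N) {n} {xs : Vector (Carrier M) n} →
                Generates M xs → Generates N (map (_≅_.to f) xs)
  ≅-generates f gens y =
    let x , fx≈y = ≅-surj f y in resp fx≈y (generated-map (≅⇒↪ f) (gens x))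

  module _ {M N : Str} {n} {xs : Vector (Carrier M) n} {ys : Vector (Carrier N) n}
           (xs-gen : Generates M xs) (ys-gen : Generates N ys)
           (xs~ys : SameType M xs N ys) where
    private
      module M = Structure M
      module N = Structure N

      SameTerm : M.Carrier → N.Carrier → Set ℓ
      SameTerm x y = Σ[ t ∈ Term 𝒫 n ] (M.⟦ t ⟧ᵗ xs M.≈ x × N.⟦ t ⟧ᵗ ys N.≈ y)

      coherent : ∀ {k} (us : Vector M.Carrier k) vs →
                 (∀ i → SameTerm (us i) (vs i)) → SameType M us N vs
      coherent us vs r =
        SameType-trans (SameType-sym (SameType-pointwise M (proj₁ ∘ proj₂ ∘ r)))
          (SameType-trans (SameType-terms xs~ys (proj₁ ∘ r))
            (SameType-pointwise N (proj₂ ∘ proj₂ ∘ r)))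

      total : ∀ x → ∃[ y ] SameTerm x y
      total x = let t , e = generated-term (xs-gen x) in N.⟦ t ⟧ᵗ ys , t , e , N.refl

    -- Every element is the value of a term at the generators; evaluating the same term at the other
    -- tuple is coherent by `SameType-terms`.
    SameType⇒≅ : M ≅ N
    SameType⇒≅ = relation⇒≅ SameTerm coherent total λ y →
      let t , e = generated-term (ys-gen y) in M.⟦ t ⟧ᵗ xs , t , M.refl , e

    SameType⇒≅-gen : ∀ i → _≅_.to SameType⇒≅ (xs i) N.≈ ys i
    SameType⇒≅-gen i = relation⇒↪-unique SameTerm coherent total (var i , M.refl , N.refl)

  ≅-sym : ∀ {M N : Str} → M ≅ N → N ≅ M
  ≅-sym {M} {N} f = relation⇒≅ (λ y x → f.to x N.≈ y)
    (λ ys xs e → SameType-trans (SameType-sym (SameType-pointwise N e))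
                   (SameType-sym (↪-SameType f.embedding xs)))
    (≅-surj f) (λ x → f.to x , N.refl)
    where
    module N = Structure N
    module f = _≅_ f

  ⟨_⟩ : ∀ {M : Str} {n} → Vector (Carrier M) n → Substructure M
  ⟨_⟩ {M} xs = record { member = Generated M xs ; resp = resp ; closed = fun }

  ⟨⟩-generated : ∀ {M : Str} {n} {xs : Vector (Carrier M) n} {x} (g : Generated M xs x) →
                 Generated (M ↾ ⟨ xs ⟩) (λ i → xs i , gen i) (x , g)
  ⟨⟩-generated (gen i)    = gen i
  ⟨⟩-generated (fun F gs) = fun F (λ i → ⟨⟩-generated (gs i))
  ⟨⟩-generated (resp e g) = resp e (⟨⟩-generated g)

  ⟨⟩-generates : ∀ {M : Str} {n} (xs : Vector (Carrier M) n) →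
                 Generates (M ↾ ⟨ xs ⟩) (λ i → xs i , gen i)
  ⟨⟩-generates xs (x , g) = ⟨⟩-generated g

  ⟨⟩-finitelyGenerated : ∀ {M : Str} {n} (xs : Vector (Carrier M) n) →
                         FinitelyGenerated (M ↾ ⟨ xs ⟩)
  ⟨⟩-finitelyGenerated xs = _ , _ , ⟨⟩-generates xs

  ⟨⟩-SameType : ∀ {M : Str} {n} (xs : Vector (Carrier M) n) →
                SameType (M ↾ ⟨ xs ⟩) (λ i → xs i , gen i) M xs
  ⟨⟩-SameType xs = ↪-SameType (↾-inclusion _ ⟨ xs ⟩) _

  corestrict : ∀ {M N : Str} (S : Substructure N) (f : M ↪ N) →
               (∀ x → Substructure.member S (to f x)) → M ↪ N ↾ S
  corestrict {M} {N} S f h = embedding M (N ↾ S) (λ x → to f x , h x)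
    (_↪_.cong f) (_↪_.commutes f) (↪-pred f) (_↪_.injective f)

  Age-member : ∀ {M N : Str} {n} (xs : Vector (Carrier M) n) → N ≅ M ↾ ⟨ xs ⟩ → Age M N
  Age-member xs f = ⟨ xs ⟩ , ⟨⟩-finitelyGenerated xs , f

  Age⇒↪ : ∀ {M N : Str} → Age M N → N ↪ M
  Age⇒↪ {M} (S , _ , f) = ↪-trans (≅⇒↪ f) (↾-inclusion M S)

  Age⇒finitelyGenerated : ∀ {M N : Str} → Age M N → FinitelyGenerated N
  Age⇒finitelyGenerated (S , (_ , _ , gens) , f) = _ , _ , ≅-generates (≅-sym f) gens

  -- The copy of `N` in `M` is generated by the images of its generators.
  ↪⇒Age : ∀ {M N : Str} → FinitelyGenerated N → N ↪ M → Age M N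
  ↪⇒Age {M} {N} (_ , xs , gens) f = Age-member (map (to f) xs)
    (SameType⇒≅ gens (⟨⟩-generates _)
      (SameType-trans (↪-SameType f xs) (SameType-sym (⟨⟩-SameType (map (to f) xs)))))

  -- Homogeneous structures and amalgamation in their age.

  module _ {M : Str} (hom : Homogeneous M) where
    private module M = Structure M

    -- Tuples of the same type generate substructures that are isomorphic generator by generator,
    -- and homogeneity extends this isomorphism.
    homogeneous-tuples : ∀ {n} {xs ys : Vector M.Carrier n} → SameType M xs M ys →
                         Σ[ g ∈ Automorphism M ] (∀ i → _≅_.to g (xs i) M.≈ ys i)
    homogeneous-tuples {xs = xs} {ys} xs~ys =
      let g , extends = hom ⟨ xs ⟩ ⟨ ys ⟩ (⟨⟩-finitelyGenerated xs) (⟨⟩-finitelyGenerated ys)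
                          (SameType⇒≅ (⟨⟩-generates xs) (⟨⟩-generates ys) xs~ys′)
      in g , λ i → M.trans (extends (xs i , gen i))
                     (SameType⇒≅-gen (⟨⟩-generates xs) (⟨⟩-generates ys) xs~ys′ i)
      where
      xs~ys′ = SameType-trans (⟨⟩-SameType xs)
                 (SameType-trans xs~ys (SameType-sym (⟨⟩-SameType ys)))

    homogeneous⇒AP : AP (Age M)
    homogeneous⇒AP {M₀} {M₁} {M₂} age₀ age₁ age₂ ι₁ ι₂ =
      M ↾ ⟨ zs ⟩ , Age-member zs ≅-refl ,
      corestrict ⟨ zs ⟩ ge₁ (λ x → generated-mono left  (generated-map ge₁ (gens₁ x))) ,
      corestrict ⟨ zs ⟩ e₂  (λ x → generated-mono right (generated-map e₂  (gens₂ x))) ,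
      λ x → ↪-agree (↪-trans ι₁ ge₁) (↪-trans ι₂ e₂) extends (gens₀ x)
      where
      e₁ = Age⇒↪ age₁
      e₂ = Age⇒↪ age₂
      xs₀ = proj₁ (proj₂ (Age⇒finitelyGenerated age₀))
      gens₀ = proj₂ (proj₂ (Age⇒finitelyGenerated age₀))
      xs₁ = proj₁ (proj₂ (Age⇒finitelyGenerated age₁))
      gens₁ = proj₂ (proj₂ (Age⇒finitelyGenerated age₁))
      xs₂ = proj₁ (proj₂ (Age⇒finitelyGenerated age₂))
      gens₂ = proj₂ (proj₂ (Age⇒finitelyGenerated age₂))
      -- The two tuples are the images of the generators of `M₀` through `M₁` and through `M₂`.
      extension = homogeneous-tuples
        (SameType-trans (SameType-sym (↪-SameType (↪-trans ι₁ e₁) xs₀))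
          (↪-SameType (↪-trans ι₂ e₂) xs₀))
      extends = proj₂ extension
      ge₁ = ↪-trans e₁ (≅⇒↪ (proj₁ extension))
      us = map (to ge₁) xs₁
      vs = map (to e₂) xs₂
      -- Both images together generate the amalgam, which keeps it finitely generated.
      zs = us ++ vs
      left : ∀ i → Generated M zs (us i)
      left i = resp (M.reflexive (lookup-++ˡ us vs i)) (gen (i ↑ˡ _))
      right : ∀ i → Generated M zs (vs i)
      right i = resp (M.reflexive (lookup-++ʳ us vs i)) (gen (_ ↑ʳ i))

  -- Finite partial isomorphisms.

  SameType-reindex : ∀ {M N : Str} {m n} {xs : Vector (Carrier M) n} {ys} →
                     SameType M xs N ys → (π : Fin m → Fin n) →
                     SameType M (xs ∘ π) N (ys ∘ π)
  SameType-reindex p π = SameType-terms p (var ∘ π)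

  record PartialIso (M N : Str) : Set ℓ where
    field
      {size} : ℕ
      dom    : Vector (Carrier M) size
      cod    : Vector (Carrier N) size
      same   : SameType M dom N cod

    Matches : Carrier M → Carrier N → Set ℓ
    Matches x y = ∃[ i ] (Structure._≈_ M (dom i) x × Structure._≈_ N (cod i) y)

  open PartialIso

  infix 4 _⊑_

  -- Compares matched pairs up to equality rather than tuples entry by entry, because `forth` puts
  -- the new pair in front and replaces old images by equal elements.
  _⊑_ : ∀ {M N : Str} → PartialIso M N → PartialIso M N → Set ℓ
  s ⊑ s′ = ∀ x y → Matches s x y → Matches s′ x y

  flip : ∀ {M N : Str} → PartialIso M N → PartialIso N M
  flip s = record { dom = cod s ; cod = dom s ; same = SameType-sym (same s) }

  flip-matches : ∀ {M N : Str} (s : PartialIso M N) {x y} →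
                 Matches s x y → Matches (flip s) y x
  flip-matches s (i , p , q) = i , q , p

  matches-coherent : ∀ {M N : Str} (s : PartialIso M N) {n} (xs : Vector (Carrier M) n) ys →
                     (∀ i → Matches s (xs i) (ys i)) → SameType M xs N ys
  matches-coherent {M} {N} s xs ys m =
    SameType-trans (SameType-sym (SameType-pointwise M (proj₁ ∘ proj₂ ∘ m)))
      (SameType-trans (SameType-reindex (same s) (proj₁ ∘ m))
        (SameType-pointwise N (proj₂ ∘ proj₂ ∘ m)))

  -- The extension property and back-and-forth.

  module _ {I : Set ℓ} (K : I → Str) where

    ExtensionProperty : Str → Set ℓ
    ExtensionProperty M =
      ∀ {n} i (bs : Vector (Carrier (K i)) n) (xs : Vector (Carrier M) n) →
      SameType (K i) bs M xs →
      Σ[ g ∈ K i ↪ M ] (∀ l → Structure._≈_ M (to g (bs l)) (xs l))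

    -- Any embedding of `K i` into `M` sends `bs` to a tuple of the type of `xs`; an automorphism
    -- then moves it onto `xs`.
    homogeneous⇒extension : ∀ {M : Str} → Homogeneous M → IsoClosure K ⊆ Age M →
                            ExtensionProperty M
    homogeneous⇒extension hom K⊆Age i bs xs bs~xs =
      let e = Age⇒↪ (K⊆Age (i , ≅-refl))
          g , extends = homogeneous-tuples hom
            (SameType-trans (SameType-sym (↪-SameType e bs)) bs~xs)
      in ↪-trans e (≅⇒↪ g) , extends

    module _ (em : ExcludedMiddle ℓ) where

      module _ {M N : Str} (Age⊆K : Age M ⊆ IsoClosure K) (ext : ExtensionProperty N) where
        private
          module M = Structure M
          module N = Structure N

        -- The substructure generated by `x` and the old domain is a copy of some `K i`. The
        -- extension property of `N`, applied to the old part of the generators, embeds `K i` over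
        -- the old images and so supplies an image for `x`.
        forth : (s : PartialIso M N) (x : M.Carrier) →
                Σ[ s′ ∈ PartialIso M N ] (s ⊑ s′ × ∃[ y ] Matches s′ x y)
        forth s x =
          record { dom = xs ; cod = map (to g) bs
                 ; same = SameType-trans (SameType-sym bs~xs) (↪-SameType g bs) } ,
          (λ { x y (l , p , q) → suc l , p , N.trans (g-bs l) q }) ,
          to g (bs zero) , zero , M.refl , N.refl
          where
          xs = x ∷ dom s
          i,e = Age⊆K (Age-member xs ≅-refl)
          i = proj₁ i,e
          e = ≅⇒↪ (proj₂ i,e)
          bs : Vector (Carrier (K i)) _
          bs l = to e (xs l , gen l)
          bs~xs : SameType (K i) bs M xs
          bs~xs = SameType-trans (SameType-sym (↪-SameType e _)) (⟨⟩-SameType xs)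
          extension = ext i (bs ∘ suc) (cod s)
            (SameType-trans (SameType-reindex bs~xs suc) (same s))
          g = proj₁ extension
          g-bs = proj₂ extension

        -- Countability is an injection into `ℕ`, perhaps not onto, so excluded middle decides
        -- whether `n` codes an element at all.
        forthCode : (c : Countable M) (s : PartialIso M N) (n : ℕ) →
          Σ[ s′ ∈ PartialIso M N ]
            (s ⊑ s′ × (∀ x → Injection.to c x ≡ n → ∃[ y ] Matches s′ x y))
        forthCode c s n with em {P = Σ[ x ∈ M.Carrier ] Injection.to c x ≡ n}
        ... | no ∄x = s , (λ x y m → m) , λ x cx≡n → contradiction (x , cx≡n) ∄x
        ... | yes (x₀ , cx₀≡n) =
          let s′ , s⊑s′ , y , l , p , q = forth s x₀
          in s′ , s⊑s′ , λ x cx≡n →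
             y , l , M.trans p (Injection.injective c (≡.trans cx₀≡n (≡.sym cx≡n))) , q

      module _ {M N : Str} (cᴹ : Countable M) (cᴺ : Countable N)
               (Ageᴹ : Age M ⊆ IsoClosure K) (Ageᴺ : Age N ⊆ IsoClosure K)
               (extᴹ : ExtensionProperty M) (extᴺ : ExtensionProperty N) where
        private
          module N = Structure N

          step : (s : PartialIso M N) (n : ℕ) →
            Σ[ s′ ∈ PartialIso M N ]
              (s ⊑ s′ × (∀ x → Injection.to cᴹ x ≡ n → ∃[ y ] Matches s′ x y)
                      × (∀ y → Injection.to cᴺ y ≡ n → ∃[ x ] Matches s′ x y))
          step s n =
            let s₁ , s⊑s₁ , hit₁ = forthCode Ageᴹ extᴺ cᴹ s n
                -- The back step is the forth step for the flipped partial isomorphism.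
                s₂ , s₁⊑s₂ , hit₂ = forthCode Ageᴺ extᴹ cᴺ (flip s₁) n
                s₁⊑s₂′ = λ x y m → flip-matches s₂ (s₁⊑s₂ y x (flip-matches s₁ m))
            in flip s₂ , (λ x y m → s₁⊑s₂′ x y (s⊑s₁ x y m)) ,
               (λ x e → let y , m = hit₁ x e in y , s₁⊑s₂′ x y m) ,
               (λ y e → let x , m = hit₂ y e in x , flip-matches s₂ m)

          module Limit (s₀ : PartialIso M N) where
            state : ℕ → PartialIso M N
            state zero    = s₀
            state (suc n) = proj₁ (step (state n) n)

            state-mono : ∀ {m n} → m ≤′ n → state m ⊑ state n
            state-mono ≤′-refl     x y r = r
            state-mono (≤′-step p) x y r = proj₁ (proj₂ (step _ _)) x y (state-mono p x y r)

            R : Carrier M → Carrier N → Set ℓ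
            R x y = ∃[ n ] Matches (state n) x y

            -- Finitely many matches all hold at one late enough state, since the states increase.
            R-coherent : ∀ {n} (xs : Vector (Carrier M) n) ys →
                         (∀ i → R (xs i) (ys i)) → SameType M xs N ys
            R-coherent xs ys r =
              let m , bound = upperBound (proj₁ ∘ r)
              in matches-coherent (state m) xs ys
                   (λ i → state-mono (bound i) _ _ (proj₂ (r i)))

            R-total : ∀ x → ∃[ y ] R x y
            R-total x =
              let n = Injection.to cᴹ x
                  y , m = proj₁ (proj₂ (proj₂ (step (state n) n))) x refl
              in y , suc n , m

            R-surjective : ∀ y → ∃[ x ] R x y
            R-surjective y =
              let n = Injection.to cᴺ y
                  x , m = proj₂ (proj₂ (proj₂ (step (state n) n))) y refl
              in x , suc n , m

        back-and-forth : ∀ {n} {xs : Vector (Carrier M) n} {ys : Vector (Carrier N) n} →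
                         SameType M xs N ys →
                         Σ[ h ∈ M ≅ N ] (∀ i → _≅_.to h (xs i) N.≈ ys i)
        back-and-forth xs~ys =
          relation⇒≅ R R-coherent R-total R-surjective ,
          λ i → relation⇒↪-unique R R-coherent R-total
                  (zero , i , Structure.refl M , N.refl)
          where
          start : PartialIso M N
          start = record { same = xs~ys }
          open Limit start

      -- Back-and-forth between `M` and itself starts from generators of `S` and their images under
      -- `f`; agreement on generators spreads to all of `S`.
      extension⇒homogeneous : ∀ {M : Str} → Countable M → Age M ⊆ IsoClosure K →
                              ExtensionProperty M → Homogeneous M
      extension⇒homogeneous {M} c age ext S T (_ , xs , xs-gen) _ f =
        let g , extends = back-and-forth c c age age ext ext
              (SameType-trans (SameType-sym (↪-SameType (↾-inclusion M S) xs))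
                (SameType-trans (↪-SameType (≅⇒↪ f) xs) (↪-SameType (↾-inclusion M T) _)))
        in g , λ x → ↪-agree (↪-trans (↾-inclusion M S) (≅⇒↪ g))
                       (↪-trans (≅⇒↪ f) (↾-inclusion M T)) extends (xs-gen x)

  -- The direct limit of a coded chain.

  module Union (D : ℕ → Str) (step : ∀ n → D n ↪ D (suc n))
               (code : ∀ n → Countable (D n))
               (code-step : ∀ n x → Injection.to (code (suc n)) (to (step n) x) ≡
                                    Injection.to (code n) x) where

    ν : ∀ n → Carrier (D n) → ℕ
    ν n = Injection.to (code n)

    push : ∀ {m n} → m ≤′ n → D m ↪ D n
    push ≤′-refl     = ↪-refl
    push (≤′-step p) = ↪-trans (push p) (step _)

    ν-push : ∀ {m n} (p : m ≤′ n) x → ν n (to (push p) x) ≡ ν m x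
    ν-push ≤′-refl     x = refl
    ν-push (≤′-step p) x = ≡.trans (code-step _ _) (ν-push p x)

    push≈ : ∀ {m n} (p : m ≤′ n) {x y} → ν m x ≡ ν n y →
            Structure._≈_ (D n) (to (push p) x) y
    push≈ p e = Injection.injective (code _) (≡.trans (ν-push p _) e)

    -- Pushing preserves codes, and codes are injective at stage `n`, so the pushed `xs` equal `ys`
    -- there.
    ν-fun-≤ : ∀ {m n} → m ≤′ n → ∀ F (xs : Vector (Carrier (D m)) _) ys →
              (∀ i → ν m (xs i) ≡ ν n (ys i)) →
              ν m (funᴹ (D m) F xs) ≡ ν n (funᴹ (D n) F ys)
    ν-fun-≤ {m} {n} p F xs ys e =
      ≡.trans (≡.sym (ν-push p _)) (Injection.cong (code n)
        (Structure.trans (D n) (_↪_.commutes (push p) F xs)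
          (Structure.funᴹ-cong (D n) F (λ i → push≈ p (e i)))))

    ν-fun : ∀ m n F (xs : Vector (Carrier (D m)) _) ys →
            (∀ i → ν m (xs i) ≡ ν n (ys i)) →
            ν m (funᴹ (D m) F xs) ≡ ν n (funᴹ (D n) F ys)
    ν-fun m n F xs ys e with ℕ.≤-total m n
    ... | inj₁ m≤n = ν-fun-≤ (ℕ.≤⇒≤′ m≤n) F xs ys e
    ... | inj₂ n≤m = ≡.sym (ν-fun-≤ (ℕ.≤⇒≤′ n≤m) F ys xs (≡.sym ∘ e))

    ν-pred-≤ : ∀ {m n} → m ≤′ n → ∀ P (xs : Vector (Carrier (D m)) _) ys →
               (∀ i → ν m (xs i) ≡ ν n (ys i)) →
               predᴹ (D m) P xs A.≈ predᴹ (D n) P ys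
    ν-pred-≤ {n = n} p P xs ys e = A.Eq.trans (↪-pred (push p) P xs)
      (Structure.predᴹ-cong (D n) P (λ i → push≈ p (e i)))

    ν-pred : ∀ m n P (xs : Vector (Carrier (D m)) _) ys →
             (∀ i → ν m (xs i) ≡ ν n (ys i)) →
             predᴹ (D m) P xs A.≈ predᴹ (D n) P ys
    ν-pred m n P xs ys e with ℕ.≤-total m n
    ... | inj₁ m≤n = ν-pred-≤ (ℕ.≤⇒≤′ m≤n) P xs ys e
    ... | inj₂ n≤m = A.Eq.sym (ν-pred-≤ (ℕ.≤⇒≤′ n≤m) P ys xs (≡.sym ∘ e))

    Element : Set ℓ
    Element = Σ[ n ∈ ℕ ] Carrier (D n)

    codeᵁ : Element → ℕ
    codeᵁ (n , x) = ν n x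

    -- Brings finitely many elements to a common stage, where functions and predicates can be
    -- evaluated; by `ν-fun` and `ν-pred` the choice of stage does not affect the result.
    gather : ∀ {k} (xs : Vector Element k) →
             Σ[ m ∈ ℕ ] Σ[ zs ∈ Vector (Carrier (D m)) k ] (∀ i → ν m (zs i) ≡ codeᵁ (xs i))
    gather xs =
      let m , bound = upperBound (proj₁ ∘ xs)
      in m , (λ i → to (push (bound i)) (proj₂ (xs i))) , λ i → ν-push (bound i) _

    ν-gather : ∀ {k} (xs : Vector Element k) i →
               ν (proj₁ (gather xs)) (proj₁ (proj₂ (gather xs)) i) ≡ codeᵁ (xs i)
    ν-gather xs = proj₂ (proj₂ (gather xs))

    gather-cong : ∀ {k} (xs ys : Vector Element k) →
                  (∀ i → Lift ℓ (codeᵁ (xs i) ≡ codeᵁ (ys i))) →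
                  ∀ i → ν (proj₁ (gather xs)) (proj₁ (proj₂ (gather xs)) i) ≡
                        ν (proj₁ (gather ys)) (proj₁ (proj₂ (gather ys)) i)
    gather-cong xs ys e i =
      ≡.trans (ν-gather xs i) (≡.trans (lower (e i)) (≡.sym (ν-gather ys i)))

    -- The codes are compatible with the steps, so equality of codes is
    -- equality in the direct limit.
    union : Str
    union = record
      { domain = record
        { Carrier       = Element
        ; _≈_           = λ x y → Lift ℓ (codeᵁ x ≡ codeᵁ y)
        ; isEquivalence = record
          { refl  = lift refl
          ; sym   = λ e → lift (≡.sym (lower e))
          ; trans = λ e e′ → lift (≡.trans (lower e) (lower e′))
          }
        }
      ; funᴹ       = λ F xs → let m , zs , _ = gather xs in m , funᴹ (D m) F zs
      ; funᴹ-cong  = λ F {xs} {ys} e → lift (ν-fun _ _ F _ _ (gather-cong xs ys e))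
      ; predᴹ      = λ P xs → let m , zs , _ = gather xs in predᴹ (D m) P zs
      ; predᴹ-cong = λ P {xs} {ys} e → ν-pred _ _ P _ _ (gather-cong xs ys e)
      }

    union-countable : Countable union
    union-countable = record { to = codeᵁ ; cong = lower ; injective = lift }

    inUnion : ∀ n → D n ↪ union
    inUnion n = embedding (D n) union (n ,_)
      (λ e → lift (Injection.cong (code n) e))
      (λ F xs → lift (ν-fun _ _ F _ _ (λ i → ≡.sym (ν-gather (map (n ,_) xs) i))))
      (λ P xs → ν-pred _ _ P _ _ (λ i → ≡.sym (ν-gather (map (n ,_) xs) i)))
      (λ e → Injection.injective (code n) (lower e))

    SameType-stage : ∀ {n k} (zs : Vector (Carrier (D n)) k) (xs : Vector Element k) →
                     (∀ i → ν n (zs i) ≡ codeᵁ (xs i)) → SameType (D n) zs union xs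
    SameType-stage {n} zs xs e =
      SameType-trans (↪-SameType (inUnion n) zs) (SameType-pointwise union (lift ∘ e))

    -- Finitely many generators already occur together at one stage, and their type there is their
    -- type in the union.
    Age-union : ∀ {N : Str} → Age union N →
                Σ[ n ∈ ℕ ] Σ[ k ∈ ℕ ] Σ[ zs ∈ Vector (Carrier (D n)) k ] (N ≅ D n ↾ ⟨ zs ⟩)
    Age-union (S , (k , xs , xs-gen) , f) =
      let n , zs , e = gather (proj₁ ∘ xs)
      in n , k , zs , ≅-trans f (SameType⇒≅ xs-gen (⟨⟩-generates zs)
           (SameType-trans (↪-SameType (↾-inclusion union S) xs)
             (SameType-trans (SameType-sym (SameType-stage zs _ e))
               (SameType-sym (⟨⟩-SameType zs)))))

  -- Extending a coding along an embedding.

  module _ (em : ExcludedMiddle ℓ) {M N : Str} (e : M ↪ N)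
           (cᴹ : Countable M) (cᴺ : Countable N) (n : ℕ)
           (bounded : ∀ x → proj₁ (unpair (Injection.to cᴹ x)) ≤ n) where
    private
      module M = Structure M
      module N = Structure N
      module cᴹ = Injection cᴹ
      module cᴺ = Injection cᴺ

      Image : N.Carrier → Set ℓ
      Image y = ∃[ x ] to e x N.≈ y

      codeBy : ∀ y → Dec (Image y) → ℕ
      codeBy y (yes (x , _)) = cᴹ.to x
      codeBy y (no _)        = pair (suc n) (cᴺ.to y)

      fresh : ∀ x k → cᴹ.to x ≡ pair (suc n) k → ⊥
      fresh x k eq = ℕ.<-irrefl refl (subst (_≤ n)
        (≡.trans (≡.cong (proj₁ ∘ unpair) eq) (unpair-pair₁ (suc n) k))
        (bounded x))

      -- The two decisions are independent, so the verdict of `em` can be exchanged for a known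
      -- preimage.
      codeBy-cong : ∀ {y y′} d d′ → y N.≈ y′ → codeBy y d ≡ codeBy y′ d′
      codeBy-cong (yes (x , p)) (yes (x′ , p′)) y≈y′ =
        cᴹ.cong (_↪_.injective e (N.trans p (N.trans y≈y′ (N.sym p′))))
      codeBy-cong (yes (x , p)) (no ∄)          y≈y′ = contradiction (x , N.trans p y≈y′) ∄
      codeBy-cong (no ∄)        (yes (x , p))   y≈y′ =
        contradiction (x , N.trans p (N.sym y≈y′)) ∄
      codeBy-cong (no _)        (no _)          y≈y′ = ≡.cong (pair (suc n)) (cᴺ.cong y≈y′)

      codeBy-injective : ∀ {y y′} d d′ → codeBy y d ≡ codeBy y′ d′ → y N.≈ y′
      codeBy-injective (yes (x , p)) (yes (x′ , p′)) eq =
        N.trans (N.sym p) (N.trans (_↪_.cong e (cᴹ.injective eq)) p′)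
      codeBy-injective (yes (x , _)) (no _)          eq = contradiction eq (fresh x _)
      codeBy-injective (no _)        (yes (x , _))   eq = contradiction (≡.sym eq) (fresh x _)
      codeBy-injective (no _)        (no _)          eq =
        cᴺ.injective (pair-injectiveʳ (suc n) _ _ eq)

      codeBy-bounded : ∀ y d → proj₁ (unpair (codeBy y d)) ≤ suc n
      codeBy-bounded y (yes (x , _)) = ℕ.m≤n⇒m≤1+n (bounded x)
      codeBy-bounded y (no _)        = ℕ.≤-reflexive (unpair-pair₁ (suc n) (cᴺ.to y))

    -- The first component of a code records the stage at which its element
    -- appeared, so codes of new elements never clash with inherited ones.
    extendCode : Σ[ c ∈ Countable N ]
      ((∀ x → Injection.to c (to e x) ≡ cᴹ.to x) ×
       (∀ y → proj₁ (unpair (Injection.to c y)) ≤ suc n))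
    extendCode =
      record { to = λ y → codeBy y em
             ; cong = codeBy-cong em em ; injective = codeBy-injective em em } ,
      (λ x → codeBy-cong em (yes (x , N.refl)) N.refl) ,
      (λ y → codeBy-bounded y em)

  -- Construction and uniqueness of the Fraïssé limit.

  module Fraïssé (em : ExcludedMiddle ℓ) {I : Set ℓ} (K : I → Str) (i₀ : I) (codeᴵ : I ↣ ℕ)
                 (fg : ∀ i → FinitelyGenerated (K i)) (codeᴷ : ∀ i → Countable (K i))
                 (hp : HP (IsoClosure K)) (jep : JEP (IsoClosure K)) (ap : AP (IsoClosure K)) where

    -- AP is applied over `⟨ bs ⟩`, a member of the class by HP, included in `K i` and mapped into
    -- `K j` by the isomorphism taking `bs` to `ds`.
    amalgamate : ∀ i j {k} (bs : Vector (Carrier (K i)) k) (ds : Vector (Carrier (K j)) k) →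
                 SameType (K i) bs (K j) ds →
                 Σ[ m ∈ I ] Σ[ e ∈ K j ↪ K m ] Σ[ g ∈ K i ↪ K m ]
                   (∀ l → Structure._≈_ (K m) (to g (bs l)) (to e (ds l)))
    amalgamate i j bs ds bs~ds =
      let M₃ , (m , h) , f₁ , f₂ , agree =
            ap (hp (i , ≅-refl) ⟨ bs ⟩ (⟨⟩-finitelyGenerated bs)) (i , ≅-refl) (j , ≅-refl)
               (↾-inclusion (K i) ⟨ bs ⟩)
               (↪-trans (≅⇒↪ iso) (↾-inclusion (K j) ⟨ ds ⟩))
      in m , ↪-trans f₂ (≅⇒↪ h) , ↪-trans f₁ (≅⇒↪ h) , λ l →
         _≅_.cong h (Structure.trans M₃ (agree (bs l , gen l)) (_↪_.cong f₂ (iso-gen l)))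
      where
      bs~ds′ = SameType-trans (⟨⟩-SameType bs)
                 (SameType-trans bs~ds (SameType-sym (⟨⟩-SameType ds)))
      iso = SameType⇒≅ (⟨⟩-generates bs) (⟨⟩-generates ds) bs~ds′
      iso-gen = SameType⇒≅-gen (⟨⟩-generates bs) (⟨⟩-generates ds) bs~ds′

    -- The extension problem over `K j` with number `t`: entries 1 and 2 give the index and the
    -- length, entries 3 and 4 encode the codes of the two tuples.
    record Task (j : I) (c : Countable (K j)) (t : ℕ) : Set ℓ where
      field
        i    : I
        k    : ℕ
        bs   : Vector (Carrier (K i)) k
        ds   : Vector (Carrier (K j)) k
        same : SameType (K i) bs (K j) ds
        i-code  : Injection.to codeᴵ i ≡ entry t 1
        k-code  : k ≡ entry t 2
        bs-code : ∀ l → Injection.to (codeᴷ i) (bs l) ≡ entry (entry t 3) (toℕ l)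
        ds-code : ∀ l → Injection.to c (ds l) ≡ entry (entry t 4) (toℕ l)

    Solved : ∀ {j c t m} → K j ↪ K m → Task j c t → Set ℓ
    Solved {m = m} e task =
      Σ[ g ∈ K i ↪ K m ] (∀ l → Structure._≈_ (K m) (to g (bs l)) (to e (ds l)))
      where open Task task

    -- The number `t` fixes the index, the length and, by injectivity of the codes, both tuples up
    -- to equality. Hence solving the one task picked by excluded middle solves every task numbered
    -- `t`.
    solved-unique : ∀ {j c t m} (e : K j ↪ K m) (p q : Task j c t) → Solved e p → Solved e q
    solved-unique {c = c} {m = m} e
      record { i = i ; bs = bs ; ds = ds ; i-code = ip ; k-code = refl
             ; bs-code = bp ; ds-code = dp }
      record { bs = bs′ ; ds = ds′ ; i-code = iq ; k-code = refl
             ; bs-code = bq ; ds-code = dq }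
      (g , h) with refl ← Injection.injective codeᴵ (≡.trans ip (≡.sym iq)) =
      g , λ l → Km.trans
        (_↪_.cong g (Injection.injective (codeᴷ i) (≡.trans (bq l) (≡.sym (bp l)))))
        (Km.trans (h l)
          (_↪_.cong e (Injection.injective c (≡.trans (dp l) (≡.sym (dq l))))))
      where module Km = Structure (K m)

    solve : ∀ j c t → Σ[ m ∈ I ] Σ[ e ∈ K j ↪ K m ] ((task : Task j c t) → Solved e task)
    solve j c t with em {P = Task j c t}
    ... | no ∄task = j , ↪-refl , λ task → contradiction task ∄task
    ... | yes p    =
      let m , e , solution = amalgamate (Task.i p) j (Task.bs p) (Task.ds p) (Task.same p)
      in m , e , λ task → solved-unique e p task solution

    record Stage (n : ℕ) : Set ℓ where
      field
        idx     : I
        code    : Countable (K idx)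
        bounded : ∀ x → proj₁ (unpair (Injection.to code x)) ≤ n

    open Stage

    solveAt : ∀ n (s : Stage n) → _
    solveAt n s = solve (idx s) (code s) n

    extendAt : ∀ n (s : Stage n) → _
    extendAt n s =
      let m , e , _ = solveAt n s in extendCode em e (code s) (codeᴷ m) n (bounded s)

    stage : ∀ n → Stage n
    stage zero = record
      { idx     = i₀
      ; code    = record
        -- Tag 0 marks the elements present from the start and meets the bound of stage 0.
        { to        = λ x → pair 0 (Injection.to (codeᴷ i₀) x)
        ; cong      = λ e → ≡.cong (pair 0) (Injection.cong (codeᴷ i₀) e)
        ; injective = λ e → Injection.injective (codeᴷ i₀) (pair-injectiveʳ 0 _ _ e)
        }
      ; bounded = λ x → ℕ.≤-reflexive (unpair-pair₁ 0 (Injection.to (codeᴷ i₀) x))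
      }
    stage (suc n) = record
      { idx     = proj₁ (solveAt n (stage n))
      ; code    = proj₁ (extendAt n (stage n))
      ; bounded = proj₂ (proj₂ (extendAt n (stage n)))
      }

    open Union (λ n → K (idx (stage n)))
               (λ n → proj₁ (proj₂ (solveAt n (stage n))))
               (λ n → code (stage n))
               (λ n → proj₁ (proj₂ (extendAt n (stage n)))) public

    -- Entry 0 of a task number n is not read by Task.  Being at most n, it
    -- delays the task until the elements of its stage have appeared.
    extension : ExtensionProperty K union
    extension {k} i bs xs bs~xs = ↪-trans g (inUnion (suc n)) , λ l → lift
      (≡.trans (Injection.cong (code (stage (suc n))) (g-bs l))
        (≡.trans (proj₁ (proj₂ (extendAt n (stage n))) (ds l)) (ds-code l)))
      where
      m = proj₁ (gather xs)
      bs-encoding = encode (Injection.to (codeᴷ i) ∘ bs)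
      xs-encoding = encode (codeᵁ ∘ xs)
      numbers = m ∷ Injection.to codeᴵ i ∷ k ∷ proj₁ bs-encoding ∷ proj₁ xs-encoding ∷ []
      n = proj₁ (encode numbers)
      n-entry = proj₂ (encode numbers)
      m≤n : m ≤′ n
      m≤n = ℕ.≤⇒≤′ (subst (_≤ n) (n-entry zero) (unpair-proj₁≤ n))
      ds : Vector (Carrier (K (idx (stage n)))) k
      ds l = to (push m≤n) (proj₁ (proj₂ (gather xs)) l)
      ds-code : ∀ l → Injection.to (code (stage n)) (ds l) ≡ codeᵁ (xs l)
      ds-code l = ≡.trans (ν-push m≤n _) (ν-gather xs l)
      task : Task (idx (stage n)) (code (stage n)) n
      task = record
        { i = i ; k = k ; bs = bs ; ds = ds
        ; same = SameType-trans bs~xs (SameType-sym (SameType-stage {n} ds xs ds-code))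
        ; i-code = ≡.sym (n-entry (suc zero))
        ; k-code = ≡.sym (n-entry (suc (suc zero)))
        ; bs-code = λ l → ≡.sym (≡.trans
            (≡.cong (λ c → entry c (toℕ l)) (n-entry (suc (suc (suc zero)))))
            (proj₂ bs-encoding l))
        ; ds-code = λ l → ≡.trans (ds-code l) (≡.sym (≡.trans
            (≡.cong (λ c → entry c (toℕ l)) (n-entry (suc (suc (suc (suc zero))))))
            (proj₂ xs-encoding l)))
        }
      -- Task `n` is solved in passing from stage `n` to the next, so `g` lands in stage `suc n`.
      solution = proj₂ (proj₂ (solveAt n (stage n))) task
      g = proj₁ solution
      g-bs = proj₂ solution

    -- Each stage is a member of `K`, so HP applies to its finitely generated substructures.
    Age⊆K : Age union ⊆ IsoClosure K
    Age⊆K age =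
      let n , k , zs , f = Age-union age
          i , h = hp (idx (stage n) , ≅-refl) ⟨ zs ⟩ (⟨⟩-finitelyGenerated zs)
      in i , ≅-trans f h

    K↪union : ∀ i → K i ↪ union
    K↪union i =
      let M₃ , _ , f , f₀ = jep (i , ≅-refl) (i₀ , ≅-refl)
      in proj₁ (extension i [] [] (SameType-trans (SameType-[] f)
           -- Stage 0 is `K i₀`, which links the empty tuple of `M₃` to that of the union.
           (SameType-trans (SameType-sym (SameType-[] f₀)) (SameType-[] (inUnion 0)))))

    K⊆Age : IsoClosure K ⊆ Age union
    K⊆Age (i , f) =
      ↪⇒Age (_ , _ , ≅-generates (≅-sym f) (proj₂ (proj₂ (fg i)))) (↪-trans (≅⇒↪ f) (K↪union i))

    homogeneous : Homogeneous union
    homogeneous = extension⇒homogeneous K em union-countable Age⊆K extension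

    -- Both structures have the extension property. Back-and-forth can start from the empty tuples
    -- because `K i₀` embeds in both.
    unique : ∀ N → Countable N → Homogeneous N → IsoClosure K ≐ Age N → union ≅ N
    unique N c hom (K⊆AgeN , AgeN⊆K) = proj₁
      (back-and-forth K em union-countable c Age⊆K AgeN⊆K extension
        (homogeneous⇒extension K hom K⊆AgeN)
        (SameType-trans (SameType-sym (SameType-[] (K↪union i₀)))
          (SameType-[] (Age⇒↪ (K⊆AgeN (i₀ , ≅-refl))))))

theorem2 : ∀ {ℓ} → ExcludedMiddle ℓ →
    (𝔸 : ULAlgebra ℓ) → IsULChain 𝔸 → (𝒫 : Language ℓ) →
    ({I : Set ℓ} (K : I → Structure 𝔸 𝒫) →
    I → I ↣ ℕ →
    (∀ i → FinitelyGenerated (K i)) → (∀ i → Countable (K i)) →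
    HP (IsoClosure K) → JEP (IsoClosure K) → AP (IsoClosure K) →
    Σ[ M ∈ Structure 𝔸 𝒫 ]
    ((Countable M × Homogeneous M × (IsoClosure K ≐ Age M)) ×
    (∀ N → Countable N → Homogeneous N → IsoClosure K ≐ Age N → M ≅ N)))
    ×
    (∀ (M : Structure 𝔸 𝒫) → Homogeneous M → AP (Age M))
theorem2 em 𝔸 _ 𝒫 =
  (λ K i₀ codeᴵ fg codeᴷ hp jep ap →
    let open Fraïssé em K i₀ codeᴵ fg codeᴷ hp jep ap
    in _ , (union-countable , homogeneous , K⊆Age , Age⊆K) , unique) ,
  λ M hom → homogeneous⇒AP hom
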